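{- Let $q$ be an odd prime power and let $\gamma\in\mathbb{F}_{q^2}$. The polynomial $f(x)=x+\gamma\,\mathrm{Tr}\left(x^{q+1}\right)$ over $\mathbb{F}_{q^2}$ is a permutation polynomial if and only if $\gamma=0$.
   Context: $\mathrm{Tr}:\mathbb{F}_{q^2}\to\mathbb{F}_q$ is the trace map $\mathrm{Tr}(x)=x+x^q$. A polynomial $f$ over $\mathbb{F}_{q^2}$ is a permutation polynomial if the map $x\mapsto f(x)$ is a bijection of $\mathbb{F}_{q^2}$ onto itself. -}

module Defs where

open import Algebra.Apartness.Bundles using (HeytingCommutativeRing; HeytingField)
open import Algebra.Bundles using (CommutativeRing)
import Algebra.Properties.Semiring.Exp as Exp
open import Data.Fin.Base using (Fin)
open import Data.Nat.Base as ℕ using (ℕ; suc; NonZero)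
open import Data.Nat.Primality using (Prime)
open import Data.Product.Base using (_×_; ∃-syntax)
open import Function.Bundles using (Bijection)
open import Function.Definitions using (Bijective)
open import Level using (Level; _⊔_)
open import Relation.Binary.PropositionalEquality using (_≡_; setoid)

IsPrimePower : ℕ → Set
IsPrimePower q = ∃[ p ] ∃[ k ] Prime p × NonZero k × q ≡ p ℕ.^ k

-- A Heyting field is automatically nontrivial: 0 ≈ 1 would make x - x
-- invertible, hence x # x.  When it is finite, _≈_ is decidable and _#_
-- coincides with _≉_, so this is the classical notion of a finite field.
module FieldDefs {c ℓ₁ ℓ₂ : Level} (K : HeytingField c ℓ₁ ℓ₂) where

  open CommutativeRing
    (HeytingCommutativeRing.commutativeRing (HeytingField.heytingCommutativeRing K))
    using (Carrier; _≈_; _+_; _*_; semiring)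
    renaming (setoid to K-setoid)
  open Exp semiring using (_^_)

  HasCardinality : ℕ → Set (c ⊔ ℓ₁)
  HasCardinality n = Bijection (setoid (Fin n)) K-setoid

  -- The trace of 𝔽_{q²} over 𝔽_q when K has q² elements.  Its values, which lie
  -- in 𝔽_q, are taken in K through the inclusion 𝔽_q ⊆ 𝔽_{q²}.
  Tr : ℕ → Carrier → Carrier
  Tr q x = x + x ^ q

  f : ℕ → Carrier → Carrier → Carrier
  f q γ x = x + γ * Tr q (x ^ suc q)

  -- Stated for the function x ↦ g(x) induced by a polynomial g.
  IsPermutation : (Carrier → Carrier) → Set (c ⊔ ℓ₁)
  IsPermutation g = Bijective _≈_ _≈_ g

{-# OPTIONS --safe #-}

-- On 𝔽_{q²} we have (x^{q+1})^q = x^{q+1}, so f(x) = x(1 + 2γx^q).  As q is odd,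
-- γ ≠ 0 makes 2γ invertible; with z = -1/(2γ) the point x = z^q satisfies
-- x^q = z, hence f(x) = 0 = f(0) although x ≠ 0.
module Submission where

open import Defs
open import Algebra.Apartness.Bundles using (HeytingField)
open import Data.Nat.Base using (ℕ; _^_)
open import Data.Nat.Divisibility using (_∤_)
open import Function.Bundles using (_⇔_)
open import Level using (Level)

open import Algebra.Apartness.Bundles using (HeytingCommutativeRing)
open import Algebra.Bundles using (CommutativeMonoid; CommutativeRing)
open import Data.Fin.Base using (Fin; zero; suc; punchIn)
open import Data.Fin.Permutation as Perm using (Permutation′; permutation; _⟨$⟩ʳ_)
open import Data.Fin.Properties using (punchInᵢ≢i)
open import Data.Nat.Base as ℕ using (zero; suc)
open import Data.Nat.Divisibility using (_∣0; ∣-refl; ∣m∣n⇒∣m+n)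
import Data.Nat.Properties as ℕ
open import Data.Product.Base using (_,_; proj₁; proj₂)
open import Data.Vec.Functional using (replicate)
open import Function.Base using (_∘_; case_of_)
open import Function.Bundles using (Inverse; mk⇔)
open import Function.Definitions using (Injective)
open import Function.Properties.Bijection using (Bijection⇒Inverse)
open import Relation.Binary.PropositionalEquality as ≡ using (_≡_)
open import Relation.Nullary.Negation using (¬_; contradiction)

import Algebra.Apartness.Properties.HeytingCommutativeRing as HeytingProperties
import Algebra.Properties.CommutativeMonoid.Mult as Mult
import Algebra.Properties.CommutativeMonoid.Sum as Sum
import Algebra.Properties.CommutativeSemiring.Exp as Exp
import Algebra.Properties.Group as GroupProperties
import Algebra.Properties.Ring as RingProperties
import Relation.Binary.Reasoning.Setoid as ≈-Reasoning

-- Translations of a finite commutative monoid, acting on indices.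

module Translation {c ℓ} (M : CommutativeMonoid c ℓ) {n : ℕ}
  (enum : Inverse (≡.setoid (Fin n)) (CommutativeMonoid.setoid M)) where

  open CommutativeMonoid M
  open Inverse enum

  cancel-translation : ∀ {u v} → u ∙ v ≈ ε → ∀ i → from (u ∙ to (from (v ∙ to i))) ≡ i
  cancel-translation {u} {v} uv≈ε i = inverseʳ (begin
    u ∙ to (from (v ∙ to i))  ≈⟨ ∙-congˡ (inverseˡ ≡.refl) ⟩
    u ∙ (v ∙ to i)            ≈⟨ assoc u v (to i) ⟨
    u ∙ v ∙ to i              ≈⟨ ∙-congʳ uv≈ε ⟩
    ε ∙ to i                  ≈⟨ identityˡ (to i) ⟩
    to i                      ∎)
    where open ≈-Reasoning setoid

  -- The inverse `v` supplies the inverse permutation. Moving the action to `Fin n` makes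
  -- rearrangement of finite sums applicable; it serves both addition by `x` and multiplication by a
  -- unit.
  translation : ∀ {u v} → u ∙ v ≈ ε → Permutation′ n
  translation {u} {v} uv≈ε = permutation (λ i → from (u ∙ to i)) (λ i → from (v ∙ to i))
    (cancel-translation uv≈ε) (cancel-translation (trans (comm v u) uv≈ε))

  to-translation : ∀ {u v} (uv≈ε : u ∙ v ≈ ε) i → to (translation uv≈ε ⟨$⟩ʳ i) ≈ u ∙ to i
  to-translation _ _ = inverseˡ ≡.refl

module _ {c ℓ} (M : CommutativeMonoid c ℓ) where

  open CommutativeMonoid M
  open Mult M
  open ≈-Reasoning setoid

  -- Copies of `x` cancel in pairs, so the induction descends by two, and oddness makes it end at
  -- one copy.
  ×-odd : ∀ {x} → x ∙ x ≈ ε → ∀ n → 2 ∤ n → n × x ≈ x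
  ×-odd xx≈ε zero              2∤n = contradiction (2 ∣0) 2∤n
  ×-odd xx≈ε (suc zero)        2∤n = identityʳ _
  ×-odd {x} xx≈ε (suc (suc n)) 2∤n = begin
    x ∙ (x ∙ n × x)  ≈⟨ assoc x x (n × x) ⟨
    x ∙ x ∙ n × x    ≈⟨ ∙-congʳ xx≈ε ⟩
    ε ∙ n × x        ≈⟨ identityˡ (n × x) ⟩
    n × x            ≈⟨ ×-odd xx≈ε n (2∤n ∘ ∣m∣n⇒∣m+n ∣-refl) ⟩
    x                ∎

module HeytingFieldProperties {c ℓ₁ ℓ₂} (K : HeytingField c ℓ₁ ℓ₂) where

  open HeytingField K using (#⇒invertible; #-irrefl; tight; heytingCommutativeRing)
  open CommutativeRing (HeytingCommutativeRing.commutativeRing heytingCommutativeRing)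
    hiding (zero)
  open Exp commutativeSemiring using (^-congˡ; ^-assocʳ; ^-distrib-*)
    renaming (_^_ to _^ᴷ_)
  open HeytingProperties heytingCommutativeRing using (1#0)
  open RingProperties ring
    using (x[y-z]≈xy-xz; +-identityʳ-unique)
  open GroupProperties +-group using (//-rightDividesˡ; x≈y⇒x∙y⁻¹≈ε)
  open Mult +-commutativeMonoid using (_×_; ×-assocˡ; ×-congʳ)
  open ≈-Reasoning setoid

  -- Cancellation in a Heyting field.

  1≉0 : 1# ≉ 0#
  1≉0 1≈0 = #-irrefl 1≈0 1#0

  -- Tightness reduces the claim to refuting `y # z`. It is `y - z`, not `x`, that gets inverted:
  -- `x` is known only to be unequal to zero, and `x * (y - z) ≈ 0#` would make it zero.
  *-cancelˡ-nonZero : ∀ {x y z} → x ≉ 0# → x * y ≈ x * z → y ≈ z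
  *-cancelˡ-nonZero {x} {y} {z} x≉0 xy≈xz = proj₁ (tight y z) λ y#z →
    case #⇒invertible y#z of λ (w , _ , [y-z]w≈1) → x≉0 (begin
      x                    ≈⟨ *-identityʳ x ⟨
      x * 1#               ≈⟨ *-congˡ [y-z]w≈1 ⟨
      x * ((y - z) * w)    ≈⟨ *-assoc x (y - z) w ⟨
      x * (y - z) * w      ≈⟨ *-congʳ (x[y-z]≈xy-xz x y z) ⟩
      (x * y - x * z) * w  ≈⟨ *-congʳ (x≈y⇒x∙y⁻¹≈ε xy≈xz) ⟩
      0# * w               ≈⟨ zeroˡ w ⟩
      0#                   ∎)

  *-nonZero : ∀ {x y} → x ≉ 0# → y ≉ 0# → x * y ≉ 0#
  *-nonZero {x} x≉0 y≉0 xy≈0 =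
    y≉0 (*-cancelˡ-nonZero x≉0 (trans xy≈0 (sym (zeroʳ x))))

  -- Sums and products over all field elements.

  module ∏ = Sum *-commutativeMonoid
  module ∑ = Sum +-commutativeMonoid

  product-nonZero : ∀ {n} (t : Fin n → Carrier) → (∀ i → t i ≉ 0#) → ∏.sum t ≉ 0#
  product-nonZero {zero}  t t≉0 = 1≉0
  product-nonZero {suc n} t t≉0 =
    *-nonZero (t≉0 zero) (product-nonZero (t ∘ suc) (t≉0 ∘ suc))

  -- Adding `x` permutes the field, so the sum of all elements absorbs `n × x`.
  cardinality×x≈0 : ∀ {n} → Inverse (≡.setoid (Fin n)) setoid → ∀ x → n × x ≈ 0#
  cardinality×x≈0 {n} enum x = +-identityʳ-unique (∑.sum to) (n × x) (begin
    ∑.sum to + n × x                  ≈⟨ +-comm _ _ ⟩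
    n × x + ∑.sum to                  ≈⟨ +-congʳ (∑.sum-replicate n) ⟨
    ∑.sum (replicate n x) + ∑.sum to  ≈⟨ ∑.∑-distrib-+ (replicate n x) to ⟨
    ∑.sum (λ i → x + to i)            ≈⟨ ∑.sum-cong-≋ (to-translation x-x≈0) ⟨
    ∑.sum (λ i → to (π ⟨$⟩ʳ i))       ≈⟨ ∑.sum-permute to π ⟨
    ∑.sum to                          ∎)
    where
    open Inverse enum using (to)
    open Translation +-commutativeMonoid enum
    x-x≈0 = -‿inverseʳ x
    π = translation x-x≈0

  -- If `x + x` vanishes, multiplying by the odd number `q` fixes `x`; doing so twice gives `q ^ 2`
  -- copies of `x`, which vanish by the cardinality.
  x+x≈0⇒x≈0 : ∀ {q} → 2 ∤ q → Inverse (≡.setoid (Fin (q ^ 2))) setoid →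
              ∀ {x} → x + x ≈ 0# → x ≈ 0#
  x+x≈0⇒x≈0 {q} 2∤q enum {x} x+x≈0 = begin
    x              ≈⟨ q×x≈x ⟨
    q × x          ≈⟨ ×-congʳ q q×x≈x ⟨
    q × (q × x)    ≈⟨ ×-assocˡ x q q ⟩
    -- `q ^ 2` unfolds to `q * (q * 1)`, so the trailing factor has to be adjusted.
    (q ℕ.* q) × x  ≡⟨ ≡.cong (λ r → (q ℕ.* r) × x) (ℕ.*-identityʳ q) ⟨
    (q ^ 2) × x    ≈⟨ cardinality×x≈0 enum x ⟩
    0#             ∎
    where q×x≈x = ×-odd +-commutativeMonoid x+x≈0 q 2∤q

  -- Multiplication by z permutes the nonzero elements, so their product P
  -- satisfies P = z^(n-1) P.
  x^cardinality≈x : ∀ {n} → Inverse (≡.setoid (Fin n)) setoid →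
                    ∀ {z w} → z * w ≈ 1# → z ^ᴷ n ≈ z
  x^cardinality≈x {zero} enum = contradiction (Inverse.from enum 0#) λ()
  x^cardinality≈x {suc n} enum {z} {w} zw≈1 = begin
    z * z ^ᴷ n  ≈⟨ *-congˡ z^n≈1 ⟩
    z * 1#      ≈⟨ *-identityʳ z ⟩
    z           ∎
    where
    open Inverse enum using (to; from; inverseˡ; inverseʳ)
    open Translation *-commutativeMonoid enum

    π = translation zw≈1
    o = from 0#
    -- Multiplication fixes the index `o` of zero, so deleting it leaves a permutation of the
    -- indices of the nonzero elements.
    π₀ = Perm.remove o π

    to-o≈0 : to o ≈ 0#
    to-o≈0 = inverseˡ ≡.refl

    π-fixes-o : π ⟨$⟩ʳ o ≡ o
    π-fixes-o = inverseʳ (begin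
      z * to o  ≈⟨ *-congˡ to-o≈0 ⟩
      z * 0#    ≈⟨ zeroʳ z ⟩
      0#        ≈⟨ to-o≈0 ⟨
      to o      ∎)

    nonZeros : Fin n → Carrier
    nonZeros = to ∘ punchIn o

    nonZeros≉0 : ∀ i → nonZeros i ≉ 0#
    nonZeros≉0 i eq = punchInᵢ≢i o i (≡.sym (inverseʳ (sym eq)))

    nonZeros-permuted : ∀ i → nonZeros (π₀ ⟨$⟩ʳ i) ≈ z * nonZeros i
    nonZeros-permuted i = begin
      -- `punchIn-permute` places the gap at the image of `o`, which is `o` itself.
      to (punchIn o (π₀ ⟨$⟩ʳ i))             ≡⟨ ≡.cong (λ j → to (punchIn j (π₀ ⟨$⟩ʳ i))) π-fixes-o ⟨
      to (punchIn (π ⟨$⟩ʳ o) (π₀ ⟨$⟩ʳ i))    ≡⟨ ≡.cong to (Perm.punchIn-permute π o i) ⟨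
      to (π ⟨$⟩ʳ punchIn o i)                ≈⟨ to-translation zw≈1 (punchIn o i) ⟩
      z * to (punchIn o i)                   ∎

    P = ∏.sum nonZeros

    z^n≈1 : z ^ᴷ n ≈ 1#
    z^n≈1 = *-cancelˡ-nonZero (product-nonZero nonZeros nonZeros≉0) (begin
      P * z ^ᴷ n                          ≈⟨ *-comm P (z ^ᴷ n) ⟩
      z ^ᴷ n * P                          ≈⟨ *-congʳ (∏.sum-replicate n) ⟨
      ∏.sum (replicate n z) * P           ≈⟨ ∏.∑-distrib-+ (replicate n z) nonZeros ⟨
      ∏.sum (λ i → z * nonZeros i)        ≈⟨ ∏.sum-cong-≋ nonZeros-permuted ⟨
      ∏.sum (nonZeros ∘ (π₀ ⟨$⟩ʳ_))       ≈⟨ ∏.sum-permute nonZeros π₀ ⟨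
      P                                   ≈⟨ *-identityʳ P ⟨
      P * 1#                              ∎)

  -- The map `f` and its collision with the value at zero.

  open FieldDefs K

  -- The hypotheses say that the `q`-th power swaps `x` and `z`. It therefore fixes the norm
  -- `x * z`, whose trace is then twice itself.
  f-conjugate : ∀ q γ {x z} → z ^ᴷ q ≈ x → x ^ᴷ q ≈ z → f q γ x ≈ x + x * ((γ + γ) * z)
  f-conjugate q γ {x} {z} z^q≈x x^q≈z = +-congˡ (begin
    γ * (x ^ᴷ suc q + (x ^ᴷ suc q) ^ᴷ q)  ≈⟨ *-congˡ (+-cong norm≈xz norm^q≈xz) ⟩
    γ * (x * z + x * z)                   ≈⟨ distribˡ γ (x * z) (x * z) ⟩
    γ * (x * z) + γ * (x * z)             ≈⟨ distribʳ (x * z) γ γ ⟨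
    (γ + γ) * (x * z)                     ≈⟨ *-assoc (γ + γ) x z ⟨
    (γ + γ) * x * z                       ≈⟨ *-congʳ (*-comm (γ + γ) x) ⟩
    x * (γ + γ) * z                       ≈⟨ *-assoc x (γ + γ) z ⟩
    x * ((γ + γ) * z)                     ∎)
    where
    norm≈xz : x ^ᴷ suc q ≈ x * z
    norm≈xz = *-congˡ x^q≈z

    norm^q≈xz : (x ^ᴷ suc q) ^ᴷ q ≈ x * z
    norm^q≈xz = begin
      (x ^ᴷ suc q) ^ᴷ q  ≈⟨ ^-congˡ q norm≈xz ⟩
      (x * z) ^ᴷ q       ≈⟨ ^-distrib-* x z q ⟩
      x ^ᴷ q * z ^ᴷ q    ≈⟨ *-cong x^q≈z z^q≈x ⟩
      z * x              ≈⟨ *-comm z x ⟩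
      x * z              ∎

  -- Oddness excludes `q = 0`, where the power would be `1#`.
  0^q≈0 : ∀ q → 2 ∤ q → 0# ^ᴷ q ≈ 0#
  0^q≈0 zero    2∤q = contradiction (2 ∣0) 2∤q
  0^q≈0 (suc q) 2∤q = zeroˡ (0# ^ᴷ q)

  injective⇒γ≈0 : ∀ {q} → 2 ∤ q → HasCardinality (q ^ 2) → ∀ {γ} →
                  Injective _≈_ _≈_ (f q γ) → γ ≈ 0#
  injective⇒γ≈0 {q} 2∤q card {γ} inj =
    -- Tightness leaves only the apart case to refute. With `0#` on the left, the inverse obtained
    -- is that of `0# - (γ + γ)`, which is the required -1/(2γ) with its sign.
    x+x≈0⇒x≈0 2∤q enum (sym (proj₁ (tight 0# (γ + γ)) λ 0#2γ →
      case #⇒invertible 0#2γ of λ (_ , z[0-2γ]≈1 , _) → collision z[0-2γ]≈1))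
    where
    enum = Bijection⇒Inverse card

    collision : ∀ {z} → ¬ (z * (0# - (γ + γ)) ≈ 1#)
    collision {z} z[0-2γ]≈1 = 1≉0 (begin
      1#                     ≈⟨ z[0-2γ]≈1 ⟨
      z * (0# - (γ + γ))     ≈⟨ *-congʳ z≈0 ⟩
      0# * (0# - (γ + γ))    ≈⟨ zeroˡ _ ⟩
      0#                     ∎)
      where
      x = z ^ᴷ q

      x^q≈z : x ^ᴷ q ≈ z
      x^q≈z = begin
        (z ^ᴷ q) ^ᴷ q    ≈⟨ ^-assocʳ z q q ⟩
        z ^ᴷ (q ℕ.* q)   ≡⟨ ≡.cong (λ r → z ^ᴷ (q ℕ.* r)) (ℕ.*-identityʳ q) ⟨
        z ^ᴷ (q ^ 2)     ≈⟨ x^cardinality≈x enum z[0-2γ]≈1 ⟩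
        z                ∎

      1+2γz≈0 : 1# + (γ + γ) * z ≈ 0#
      1+2γz≈0 = begin
        1# + (γ + γ) * z                     ≈⟨ +-cong (sym z[0-2γ]≈1) (*-comm (γ + γ) z) ⟩
        z * (0# - (γ + γ)) + z * (γ + γ)     ≈⟨ distribˡ z _ _ ⟨
        z * (0# - (γ + γ) + (γ + γ))         ≈⟨ *-congˡ (//-rightDividesˡ (γ + γ) 0#) ⟩
        z * 0#                               ≈⟨ zeroʳ z ⟩
        0#                                   ∎

      fx≈f0 : f q γ x ≈ f q γ 0#
      fx≈f0 = begin
        f q γ x                       ≈⟨ f-conjugate q γ refl x^q≈z ⟩
        x + x * ((γ + γ) * z)         ≈⟨ +-congʳ (*-identityʳ x) ⟨
        x * 1# + x * ((γ + γ) * z)    ≈⟨ distribˡ x 1# _ ⟨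
        x * (1# + (γ + γ) * z)        ≈⟨ *-congˡ 1+2γz≈0 ⟩
        x * 0#                        ≈⟨ zeroʳ x ⟩
        -- Zero is its own conjugate, so `f-conjugate` evaluates `f` there too.
        0#                            ≈⟨ zeroˡ _ ⟨
        0# * ((γ + γ) * 0#)           ≈⟨ +-identityˡ _ ⟨
        0# + 0# * ((γ + γ) * 0#)      ≈⟨ f-conjugate q γ (0^q≈0 q 2∤q) (0^q≈0 q 2∤q) ⟨
        f q γ 0#                      ∎

      z≈0 : z ≈ 0#
      z≈0 = begin
        z         ≈⟨ x^q≈z ⟨
        -- Injectivity turns the collision into `x ≈ 0#`, and `z` is recovered from `x` as its
        -- `q`-th power.
        x ^ᴷ q    ≈⟨ ^-congˡ q (inj fx≈f0) ⟩
        0# ^ᴷ q   ≈⟨ 0^q≈0 q 2∤q ⟩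
        0#        ∎

  γ≈0⇒permutation : ∀ q {γ} → γ ≈ 0# → IsPermutation (f q γ)
  γ≈0⇒permutation q {γ} γ≈0 =
      (λ {x} {y} fx≈fy → trans (sym (fx≈x x)) (trans fx≈fy (fx≈x y)))
    , (λ y → y , λ {x} x≈y → trans (fx≈x x) x≈y)
    where
    fx≈x : ∀ x → f q γ x ≈ x
    fx≈x x = begin
      x + γ * Tr q (x ^ᴷ suc q)   ≈⟨ +-congˡ (*-congʳ γ≈0) ⟩
      x + 0# * Tr q (x ^ᴷ suc q)  ≈⟨ +-congˡ (zeroˡ _) ⟩
      x + 0#                      ≈⟨ +-identityʳ x ⟩
      x                           ∎

theorem3p3 : ∀ {c ℓ₁ ℓ₂ : Level} (q : ℕ) → IsPrimePower q → 2 ∤ q →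
    (K : HeytingField c ℓ₁ ℓ₂) → (let open HeytingField K) → (let open FieldDefs K) →
    HasCardinality (q ^ 2) → (γ : Carrier) →
    IsPermutation (f q γ) ⇔ (γ ≈ 0#)
theorem3p3 q _ 2∤q K card γ =
  mk⇔ (injective⇒γ≈0 2∤q card ∘ proj₁) (γ≈0⇒permutation q)
  where open HeytingFieldProperties K
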